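{- Let $(x_n)_{n\in\mathbb{Z}}$ be the sequence of rational functions in two indeterminates $x_1,x_2$ determined by $x_n x_{n-2}=x_{n-1}^2+1$ for all $n\in\mathbb{Z}$ (the case $(b,c)=(2,2)$). Then for every integer $n\neq 1,2$, $$x_n(x_1,x_2)=\frac{p_n(x_1,x_2)}{m_n(x_1,x_2)},$$ where $p_n$ is the sum of the weights of all perfect matchings of the weighted graph $G_n$, and $m_n$ is the monomial attached to $G_n$, both as defined in the context.
   Context: For $m\ge 1$, $H_m$ is the edge-weighted $2\times m$ grid graph (2 rows, $m$ columns of vertices): every vertical edge has weight $1$; for $1\le j\le m-1$ the two horizontal edges joining column $j$ to column $j+1$ both have weight $x_2$ if $j$ is odd and $x_1$ if $j$ is even. A perfect matching of a graph is a set $S$ of edges such that each vertex belongs to exactly one edge of $S$; its weight is the product of the weights of its edges. For $n\ge 3$: $G_n=H_{2n-4}$, $p_n(x_1,x_2)$ is the sum of the weights of all perfect matchings of $G_n$, and $m_n(x_1,x_2)=x_1^{n-2}x_2^{n-3}$. (Equivalently $m_n=x_1^ix_2^j$, where $i$ is the number of square cells of $G_n$ whose horizontal edges have weight $x_2$ and $j$ the number of those whose horizontal edges have weight $x_1$.) For $n\le 0$: $G_n$ is the graph $G_{3-n}$ with the weights $x_1$ and $x_2$ interchanged, $p_n$ is the sum of the weights of all perfect matchings of $G_n$ (so $p_n(x_1,x_2)=p_{3-n}(x_2,x_1)$), and $m_n(x_1,x_2)=m_{3-n}(x_2,x_1)=x_1^{ -n}x_2^{1-n}$. -}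

module Defs where

open import Level using (Level; _⊔_) renaming (suc to lsuc)
open import Algebra.Bundles using (CommutativeRing)
open import Algebra.Definitions using (Congruent₂; LeftIdentity; LeftInverse)
import Algebra.Properties.Ring as RingProperties
import Algebra.Properties.Semiring.Exp as Exp
import Algebra.Solver.Ring.NaturalCoefficients.Default as RingSolver
open import Data.Bool.Base using (true; false; if_then_else_)
open import Data.Fin.Base using (Fin; zero; suc; toℕ; inject₁)
import Data.Fin.Properties as Fin
open import Data.Integer.Base as ℤ using (ℤ; ∣_∣; 0ℤ; _≤ᵇ_)
open import Data.List.Base
  using (List; []; _∷_; _++_; map; foldr; filter; length; allFin; cartesianProduct)
open import Data.List.Membership.Propositional using (_∈_)
open import Data.List.Membership.Propositional.Properties
  using (∈-map⁺; ∈-allFin; ∈-cartesianProduct⁺)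
open import Data.List.Relation.Unary.All as All using (All; []; _∷_)
open import Data.List.Relation.Unary.Any using (here; there)
open import Data.List.Relation.Unary.AllPairs using ([]; _∷_)
open import Data.List.Relation.Unary.Unique.Propositional using (Unique)
open import Data.List.Relation.Unary.Unique.Propositional.Properties using (map⁺)
open import Data.Nat.Base as ℕ using (ℕ; zero; suc; _∸_)
import Data.Nat.Properties as ℕ
open import Data.Parity.Base using (Parity; 0ℙ; 1ℙ)
open import Data.Product.Base using (_×_; _,_; proj₁; proj₂)
open import Data.Product.Properties using (≡-dec)
open import Data.Rational.Base as ℚ using (ℚ; 0ℚ)
import Data.Rational.Properties as ℚ
open import Data.Sum.Base using (_⊎_; inj₁; inj₂)
open import Relation.Binary.Bundles using (Setoid)
open import Relation.Binary.Definitions using (DecidableEquality)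
open import Relation.Binary.PropositionalEquality as ≡ using (_≡_; _≢_)
import Relation.Binary.Reasoning.Setoid as SetoidReasoning
open import Relation.Nullary.Decidable using (Dec; yes; no; map′; _×-dec_; _⊎-dec_)
open import Relation.Nullary.Negation using (¬_; contradiction)

private variable
  c ℓ : Level

record IntegralDomain c ℓ : Set (lsuc (c ⊔ ℓ)) where
  field
    commutativeRing : CommutativeRing c ℓ

  open CommutativeRing commutativeRing public hiding (zero)

  field
    1≉0            : ¬ 1# ≈ 0#
    zero?          : ∀ x → Dec (x ≈ 0#)
    noZeroDivisors : ∀ {x y} → x * y ≈ 0# → x ≈ 0# ⊎ y ≈ 0#

  open RingProperties ring public using (-‿distribˡ-*)
  open Exp semiring public using (_^_)

  *-nonzero : ∀ {x y} → ¬ x ≈ 0# → ¬ y ≈ 0# → ¬ x * y ≈ 0#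
  *-nonzero x≉0 y≉0 xy≈0 with noZeroDivisors xy≈0
  ... | inj₁ x≈0 = x≉0 x≈0
  ... | inj₂ y≈0 = y≉0 y≈0

  ^-nonzero : ∀ {x} n → ¬ x ≈ 0# → ¬ x ^ n ≈ 0#
  ^-nonzero zero    x≉0 = 1≉0
  ^-nonzero (suc n) x≉0 = *-nonzero x≉0 (^-nonzero n x≉0)

  *-cancelʳ-nonzero : ∀ {x y z} → ¬ z ≈ 0# → x * z ≈ y * z → x ≈ y
  *-cancelʳ-nonzero {x} {y} {z} z≉0 xz≈yz with noZeroDivisors [x-y]z≈0
    where
    open SetoidReasoning setoid
    [x-y]z≈0 : (x + - y) * z ≈ 0#
    [x-y]z≈0 = begin
      (x + - y) * z      ≈⟨ distribʳ z x (- y) ⟩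
      x * z + - y * z    ≈⟨ +-cong xz≈yz (sym (-‿distribˡ-* y z)) ⟩
      y * z + - (y * z)  ≈⟨ -‿inverseʳ (y * z) ⟩
      0#                 ∎
  ... | inj₂ z≈0   = contradiction z≈0 z≉0
  ... | inj₁ x-y≈0 = begin
      x              ≈⟨ +-identityʳ x ⟨
      x + 0#         ≈⟨ +-congˡ (-‿inverseˡ y) ⟨
      x + (- y + y)  ≈⟨ +-assoc x (- y) y ⟨
      x + - y + y    ≈⟨ +-congʳ x-y≈0 ⟩
      0# + y         ≈⟨ +-identityˡ y ⟩
      y              ∎
    where open SetoidReasoning setoid

module Polynomial (D : IntegralDomain c ℓ) where
  open IntegralDomain D

  -- a₀ ∷ a₁ ∷ … ∷ aₙ ∷ [] is a₀ + a₁ X + … + aₙ Xⁿ; trailing zeros are allowed.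
  Poly : Set c
  Poly = List Carrier

  coeff : Poly → ℕ → Carrier
  coeff []      _       = 0#
  coeff (a ∷ p) zero    = a
  coeff (a ∷ p) (suc n) = coeff p n

  infix 4 _≋_
  record _≋_ (p q : Poly) : Set ℓ where
    constructor mk≋
    field at : ∀ n → coeff p n ≈ coeff q n
  open _≋_ public

  infixl 6 _⊕_
  infixl 7 _⊛_ _·_

  _⊕_ : Poly → Poly → Poly
  []      ⊕ q       = q
  (a ∷ p) ⊕ []      = a ∷ p
  (a ∷ p) ⊕ (b ∷ q) = a + b ∷ p ⊕ q

  _·_ : Carrier → Poly → Poly
  a · p = map (a *_) p

  _⊛_ : Poly → Poly → Poly
  []      ⊛ q = []
  (a ∷ p) ⊛ q = a · q ⊕ (0# ∷ p ⊛ q)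

  ⊖_ : Poly → Poly
  ⊖ p = map -_ p

  constant : Carrier → Poly
  constant a = a ∷ []

  X : Poly
  X = 0# ∷ 1# ∷ []

  private
    module R where
      +-swap : ∀ a b c d → (a + b) + (c + d) ≈ (a + c) + (b + d)
      +-swap a b c d = begin
        (a + b) + (c + d)  ≈⟨ +-assoc a b (c + d) ⟩
        a + (b + (c + d))  ≈⟨ +-congˡ (+-assoc b c d) ⟨
        a + ((b + c) + d)  ≈⟨ +-congˡ (+-congʳ (+-comm b c)) ⟩
        a + ((c + b) + d)  ≈⟨ +-congˡ (+-assoc c b d) ⟩
        a + (c + (b + d))  ≈⟨ +-assoc a c (b + d) ⟨
        (a + c) + (b + d)  ∎
        where open SetoidReasoning setoid

      -0≈0 : - 0# ≈ 0#
      -0≈0 = trans (sym (+-identityʳ (- 0#))) (-‿inverseˡ 0#)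

  ≋-refl : ∀ {p} → p ≋ p
  ≋-refl .at n = refl

  ≋-sym : ∀ {p q} → p ≋ q → q ≋ p
  ≋-sym e .at n = sym (e .at n)

  ≋-trans : ∀ {p q r} → p ≋ q → q ≋ r → p ≋ r
  ≋-trans e f .at n = trans (e .at n) (f .at n)

  ≋-setoid : Setoid c ℓ
  ≋-setoid = record
    { Carrier = Poly
    ; _≈_ = _≋_
    ; isEquivalence = record { refl = ≋-refl ; sym = ≋-sym ; trans = ≋-trans }
    }

  private module ≋R = SetoidReasoning ≋-setoid

  ∷-cong : ∀ {a b p q} → a ≈ b → p ≋ q → a ∷ p ≋ b ∷ q
  ∷-cong e f .at zero    = e
  ∷-cong e f .at (suc n) = f .at n

  head-≋ : ∀ {a b p q} → a ∷ p ≋ b ∷ q → a ≈ b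
  head-≋ e = e .at zero

  tail-≋ : ∀ {a b p q} → a ∷ p ≋ b ∷ q → p ≋ q
  tail-≋ e .at n = e .at (suc n)

  ∷-zero : ∀ {a p} → a ≈ 0# → p ≋ [] → a ∷ p ≋ []
  ∷-zero e f .at zero    = e
  ∷-zero e f .at (suc n) = f .at n

  tail-zero : ∀ {a p} → a ∷ p ≋ [] → p ≋ []
  tail-zero e .at n = e .at (suc n)

  coeff-⊕ : ∀ p q n → coeff (p ⊕ q) n ≈ coeff p n + coeff q n
  coeff-⊕ []      q       n       = sym (+-identityˡ _)
  coeff-⊕ (a ∷ p) []      n       = sym (+-identityʳ _)
  coeff-⊕ (a ∷ p) (b ∷ q) zero    = refl
  coeff-⊕ (a ∷ p) (b ∷ q) (suc n) = coeff-⊕ p q n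

  coeff-· : ∀ a p n → coeff (a · p) n ≈ a * coeff p n
  coeff-· a []      n       = sym (zeroʳ a)
  coeff-· a (b ∷ p) zero    = refl
  coeff-· a (b ∷ p) (suc n) = coeff-· a p n

  coeff-⊖ : ∀ p n → coeff (⊖ p) n ≈ - coeff p n
  coeff-⊖ []      n       = sym R.-0≈0
  coeff-⊖ (a ∷ p) zero    = refl
  coeff-⊖ (a ∷ p) (suc n) = coeff-⊖ p n

  ⊕-cong : ∀ {p p′ q q′} → p ≋ p′ → q ≋ q′ → p ⊕ q ≋ p′ ⊕ q′
  ⊕-cong {p} {p′} {q} {q′} e f .at n =
    trans (coeff-⊕ p q n) (trans (+-cong (e .at n) (f .at n)) (sym (coeff-⊕ p′ q′ n)))

  ⊖-cong : ∀ {p q} → p ≋ q → ⊖ p ≋ ⊖ q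
  ⊖-cong {p} {q} e .at n =
    trans (coeff-⊖ p n) (trans (-‿cong (e .at n)) (sym (coeff-⊖ q n)))

  ·-cong : ∀ {a b p q} → a ≈ b → p ≋ q → a · p ≋ b · q
  ·-cong {a} {b} {p} {q} e f .at n =
    trans (coeff-· a p n) (trans (*-cong e (f .at n)) (sym (coeff-· b q n)))

  ⊕-assoc : ∀ p q r → (p ⊕ q) ⊕ r ≋ p ⊕ (q ⊕ r)
  ⊕-assoc p q r .at n = begin
    coeff ((p ⊕ q) ⊕ r) n                ≈⟨ coeff-⊕ (p ⊕ q) r n ⟩
    coeff (p ⊕ q) n + coeff r n          ≈⟨ +-congʳ (coeff-⊕ p q n) ⟩
    (coeff p n + coeff q n) + coeff r n  ≈⟨ +-assoc _ _ _ ⟩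
    coeff p n + (coeff q n + coeff r n)  ≈⟨ +-congˡ (coeff-⊕ q r n) ⟨
    coeff p n + coeff (q ⊕ r) n          ≈⟨ coeff-⊕ p (q ⊕ r) n ⟨
    coeff (p ⊕ (q ⊕ r)) n                ∎
    where open SetoidReasoning setoid

  ⊕-comm : ∀ p q → p ⊕ q ≋ q ⊕ p
  ⊕-comm p q .at n =
    trans (coeff-⊕ p q n) (trans (+-comm _ _) (sym (coeff-⊕ q p n)))

  ⊕-identityʳ : ∀ p → p ⊕ [] ≋ p
  ⊕-identityʳ p = ⊕-comm p []

  ⊕-inverseˡ : ∀ p → ⊖ p ⊕ p ≋ []
  ⊕-inverseˡ p .at n =
    trans (coeff-⊕ (⊖ p) p n) (trans (+-congʳ (coeff-⊖ p n)) (-‿inverseˡ _))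

  ⊕-swap : ∀ p q r s → (p ⊕ q) ⊕ (r ⊕ s) ≋ (p ⊕ r) ⊕ (q ⊕ s)
  ⊕-swap p q r s .at n = begin
    coeff ((p ⊕ q) ⊕ (r ⊕ s)) n          ≈⟨ expand p q r s ⟩
    (coeff p n + coeff q n) + (coeff r n + coeff s n) ≈⟨ R.+-swap _ _ _ _ ⟩
    (coeff p n + coeff r n) + (coeff q n + coeff s n) ≈⟨ expand p r q s ⟨
    coeff ((p ⊕ r) ⊕ (q ⊕ s)) n          ∎
    where
    open SetoidReasoning setoid
    expand : ∀ p q r s → coeff ((p ⊕ q) ⊕ (r ⊕ s)) n ≈
             (coeff p n + coeff q n) + (coeff r n + coeff s n)
    expand p q r s = trans (coeff-⊕ (p ⊕ q) (r ⊕ s) n)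
                           (+-cong (coeff-⊕ p q n) (coeff-⊕ r s n))

  ·-distribˡ : ∀ a p q → a · (p ⊕ q) ≋ a · p ⊕ a · q
  ·-distribˡ a p q .at n = begin
    coeff (a · (p ⊕ q)) n                ≈⟨ coeff-· a (p ⊕ q) n ⟩
    a * coeff (p ⊕ q) n                  ≈⟨ *-congˡ (coeff-⊕ p q n) ⟩
    a * (coeff p n + coeff q n)          ≈⟨ distribˡ a _ _ ⟩
    a * coeff p n + a * coeff q n        ≈⟨ +-cong (coeff-· a p n) (coeff-· a q n) ⟨
    coeff (a · p) n + coeff (a · q) n    ≈⟨ coeff-⊕ (a · p) (a · q) n ⟨
    coeff (a · p ⊕ a · q) n              ∎
    where open SetoidReasoning setoid

  ·-distribʳ : ∀ a b p → (a + b) · p ≋ a · p ⊕ b · p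
  ·-distribʳ a b p .at n = begin
    coeff ((a + b) · p) n                ≈⟨ coeff-· (a + b) p n ⟩
    (a + b) * coeff p n                  ≈⟨ distribʳ _ a b ⟩
    a * coeff p n + b * coeff p n        ≈⟨ +-cong (coeff-· a p n) (coeff-· b p n) ⟨
    coeff (a · p) n + coeff (b · p) n    ≈⟨ coeff-⊕ (a · p) (b · p) n ⟨
    coeff (a · p ⊕ b · p) n              ∎
    where open SetoidReasoning setoid

  ·-assoc : ∀ a b p → (a * b) · p ≋ a · (b · p)
  ·-assoc a b p .at n = begin
    coeff ((a * b) · p) n      ≈⟨ coeff-· (a * b) p n ⟩
    a * b * coeff p n          ≈⟨ *-assoc a b _ ⟩
    a * (b * coeff p n)        ≈⟨ *-congˡ (coeff-· b p n) ⟨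
    a * coeff (b · p) n        ≈⟨ coeff-· a (b · p) n ⟨
    coeff (a · (b · p)) n      ∎
    where open SetoidReasoning setoid

  ·-identity : ∀ p → 1# · p ≋ p
  ·-identity p .at n = trans (coeff-· 1# p n) (*-identityˡ _)

  ·-zero : ∀ {a} p → a ≈ 0# → a · p ≋ []
  ·-zero {a} p a≈0 .at n = trans (coeff-· a p n) (trans (*-congʳ a≈0) (zeroˡ _))

  ⊛-zeroʳ : ∀ p → p ⊛ [] ≋ []
  ⊛-zeroʳ []      = ≋-refl
  ⊛-zeroʳ (a ∷ p) = ∷-zero refl (⊛-zeroʳ p)

  ⊛-congˡ : ∀ p {q q′} → q ≋ q′ → p ⊛ q ≋ p ⊛ q′
  ⊛-congˡ []      e = ≋-refl
  ⊛-congˡ (a ∷ p) e = ⊕-cong (·-cong refl e) (∷-cong refl (⊛-congˡ p e))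

  ⊛-∷ : ∀ p b q → p ⊛ (b ∷ q) ≋ b · p ⊕ (0# ∷ p ⊛ q)
  ⊛-∷ []      b q = ≋-sym (∷-zero refl ≋-refl)
  ⊛-∷ (a ∷ p) b q = ∷-cong (+-congʳ (*-comm a b)) (begin
    a · q ⊕ p ⊛ (b ∷ q)             ≈⟨ ⊕-cong (≋-refl {a · q}) (⊛-∷ p b q) ⟩
    a · q ⊕ (b · p ⊕ (0# ∷ p ⊛ q))  ≈⟨ ⊕-assoc (a · q) (b · p) _ ⟨
    a · q ⊕ b · p ⊕ (0# ∷ p ⊛ q)    ≈⟨ ⊕-cong (⊕-comm (a · q) (b · p)) ≋-refl ⟩
    b · p ⊕ a · q ⊕ (0# ∷ p ⊛ q)    ≈⟨ ⊕-assoc (b · p) (a · q) _ ⟩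
    b · p ⊕ (a · q ⊕ (0# ∷ p ⊛ q))  ∎)
    where open ≋R

  ⊛-comm : ∀ p q → p ⊛ q ≋ q ⊛ p
  ⊛-comm []      q = ≋-sym (⊛-zeroʳ q)
  ⊛-comm (a ∷ p) q =
    ≋-trans (⊕-cong (≋-refl {a · q}) (∷-cong refl (⊛-comm p q))) (≋-sym (⊛-∷ q a p))

  ⊛-cong : ∀ {p p′ q q′} → p ≋ p′ → q ≋ q′ → p ⊛ q ≋ p′ ⊛ q′
  ⊛-cong {p} {p′} {q} {q′} e f = begin
    p ⊛ q    ≈⟨ ⊛-congˡ p f ⟩
    p ⊛ q′   ≈⟨ ⊛-comm p q′ ⟩
    q′ ⊛ p   ≈⟨ ⊛-congˡ q′ e ⟩
    q′ ⊛ p′  ≈⟨ ⊛-comm q′ p′ ⟩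
    p′ ⊛ q′  ∎
    where open ≋R

  0∷-⊕ : ∀ p q → 0# ∷ p ⊕ q ≋ (0# ∷ p) ⊕ (0# ∷ q)
  0∷-⊕ p q = ∷-cong (sym (+-identityˡ 0#)) ≋-refl

  ⊛-distribʳ : ∀ r p q → (p ⊕ q) ⊛ r ≋ p ⊛ r ⊕ q ⊛ r
  ⊛-distribʳ r []      q       = ≋-refl
  ⊛-distribʳ r (a ∷ p) []      = ≋-sym (⊕-identityʳ ((a ∷ p) ⊛ r))
  ⊛-distribʳ r (a ∷ p) (b ∷ q) = begin
    (a + b) · r ⊕ (0# ∷ (p ⊕ q) ⊛ r)
      ≈⟨ ⊕-cong (·-distribʳ a b r) (∷-cong refl (⊛-distribʳ r p q)) ⟩
    (a · r ⊕ b · r) ⊕ (0# ∷ p ⊛ r ⊕ q ⊛ r)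
      ≈⟨ ⊕-cong (≋-refl {a · r ⊕ b · r}) (0∷-⊕ (p ⊛ r) (q ⊛ r)) ⟩
    (a · r ⊕ b · r) ⊕ ((0# ∷ p ⊛ r) ⊕ (0# ∷ q ⊛ r))
      ≈⟨ ⊕-swap (a · r) (b · r) (0# ∷ p ⊛ r) (0# ∷ q ⊛ r) ⟩
    (a ∷ p) ⊛ r ⊕ (b ∷ q) ⊛ r  ∎
    where open ≋R

  0∷-⊛ : ∀ p q → (0# ∷ p) ⊛ q ≋ 0# ∷ p ⊛ q
  0∷-⊛ p q = ⊕-cong (·-zero q refl) ≋-refl

  ·-0∷ : ∀ a p → a · (0# ∷ p) ≋ 0# ∷ a · p
  ·-0∷ a p = ∷-cong (zeroʳ a) ≋-refl

  ·-⊛ : ∀ a p q → (a · p) ⊛ q ≋ a · (p ⊛ q)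
  ·-⊛ a []      q = ≋-refl
  ·-⊛ a (b ∷ p) q = begin
    (a * b) · q ⊕ (0# ∷ (a · p) ⊛ q)  ≈⟨ ⊕-cong (·-assoc a b q) (∷-cong refl (·-⊛ a p q)) ⟩
    a · (b · q) ⊕ (0# ∷ a · (p ⊛ q))  ≈⟨ ⊕-cong (≋-refl {a · (b · q)}) (·-0∷ a (p ⊛ q)) ⟨
    a · (b · q) ⊕ a · (0# ∷ p ⊛ q)    ≈⟨ ·-distribˡ a (b · q) (0# ∷ p ⊛ q) ⟨
    a · (b · q ⊕ (0# ∷ p ⊛ q))        ∎
    where open ≋R

  ⊛-assoc : ∀ p q r → (p ⊛ q) ⊛ r ≋ p ⊛ (q ⊛ r)
  ⊛-assoc []      q r = ≋-refl
  ⊛-assoc (a ∷ p) q r = begin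
    (a · q ⊕ (0# ∷ p ⊛ q)) ⊛ r          ≈⟨ ⊛-distribʳ r (a · q) (0# ∷ p ⊛ q) ⟩
    (a · q) ⊛ r ⊕ (0# ∷ p ⊛ q) ⊛ r      ≈⟨ ⊕-cong (·-⊛ a q r) (0∷-⊛ (p ⊛ q) r) ⟩
    a · (q ⊛ r) ⊕ (0# ∷ (p ⊛ q) ⊛ r)
      ≈⟨ ⊕-cong (≋-refl {a · (q ⊛ r)}) (∷-cong refl (⊛-assoc p q r)) ⟩
    a · (q ⊛ r) ⊕ (0# ∷ p ⊛ (q ⊛ r))    ∎
    where open ≋R

  ⊛-identityˡ : ∀ p → constant 1# ⊛ p ≋ p
  ⊛-identityˡ p = begin
    1# · p ⊕ (0# ∷ [])  ≈⟨ ⊕-cong (·-identity p) (∷-zero refl ≋-refl) ⟩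
    p ⊕ []              ≈⟨ ⊕-identityʳ p ⟩
    p                   ∎
    where open ≋R

  polynomialRing : CommutativeRing c ℓ
  polynomialRing = record
    { Carrier = Poly
    ; _≈_ = _≋_
    ; _+_ = _⊕_
    ; _*_ = _⊛_
    ; -_  = ⊖_
    ; 0#  = []
    ; 1#  = constant 1#
    ; isCommutativeRing = record
      { isRing = record
        { +-isAbelianGroup = record
          { isGroup = record
            { isMonoid = record
              { isSemigroup = record
                { isMagma = record
                  { isEquivalence = Setoid.isEquivalence ≋-setoid
                  ; ∙-cong = ⊕-cong
                  }
                ; assoc = ⊕-assoc
                }
              ; identity = (λ _ → ≋-refl) , ⊕-identityʳ
              }
            ; inverse = ⊕-inverseˡ , λ p → ≋-trans (⊕-comm p (⊖ p)) (⊕-inverseˡ p)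
            ; ⁻¹-cong = ⊖-cong
            }
          ; comm = ⊕-comm
          }
        ; *-cong = ⊛-cong
        ; *-assoc = ⊛-assoc
        ; *-identity =
            ⊛-identityˡ , λ p → ≋-trans (⊛-comm p (constant 1#)) (⊛-identityˡ p)
        ; distrib =
            (λ r p q → ≋-trans (⊛-comm r (p ⊕ q))
              (≋-trans (⊛-distribʳ r p q) (⊕-cong (⊛-comm p r) (⊛-comm q r))))
            , ⊛-distribʳ
        }
      ; *-comm = ⊛-comm
      }
    }

  ≋[]? : ∀ p → Dec (p ≋ [])
  ≋[]? []      = yes ≋-refl
  ≋[]? (a ∷ p) =
    map′ (λ (e , f) → ∷-zero e f) (λ e → e .at zero , tail-zero e)
         (zero? a ×-dec ≋[]? p)

  private
    ⊛-zero-head : ∀ a p q → ¬ a ≈ 0# → (a ∷ p) ⊛ q ≋ [] → q ≋ []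
    ⊛-zero-head a p []      a≉0 e = ≋-refl
    ⊛-zero-head a p (b ∷ q) a≉0 e = ∷-zero b≈0 (⊛-zero-head a p q a≉0 tail)
      where
      b≈0 : b ≈ 0#
      b≈0 with noZeroDivisors (trans (sym (+-identityʳ (a * b))) (e .at zero))
      ... | inj₁ a≈0 = contradiction a≈0 a≉0
      ... | inj₂ b≈0 = b≈0

      tail : (a ∷ p) ⊛ q ≋ []
      tail = tail-zero {0#} (begin
        0# ∷ (a ∷ p) ⊛ q                     ≈⟨ ⊕-cong (·-zero (a ∷ p) b≈0) ≋-refl ⟨
        b · (a ∷ p) ⊕ (0# ∷ (a ∷ p) ⊛ q)     ≈⟨ ⊛-∷ (a ∷ p) b q ⟨
        (a ∷ p) ⊛ (b ∷ q)                    ≈⟨ e ⟩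
        []                                   ∎)
        where open ≋R

  ⊛-noZeroDivisors : ∀ {p q} → p ⊛ q ≋ [] → p ≋ [] ⊎ q ≋ []
  ⊛-noZeroDivisors {[]}    {q} e = inj₁ ≋-refl
  ⊛-noZeroDivisors {a ∷ p} {q} e with zero? a
  ... | no  a≉0 = inj₂ (⊛-zero-head a p q a≉0 e)
  ... | yes a≈0 with ⊛-noZeroDivisors {p} {q}
                       (tail-zero (≋-trans (≋-sym (⊕-cong (·-zero q a≈0) ≋-refl)) e))
  ...   | inj₁ p≋0 = inj₁ (∷-zero a≈0 p≋0)
  ...   | inj₂ q≋0 = inj₂ q≋0

  polynomials : IntegralDomain c ℓ
  polynomials = record
    { commutativeRing = polynomialRing
    ; 1≉0            = λ e → 1≉0 (e .at zero)
    ; zero?          = ≋[]?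
    ; noZeroDivisors = λ {p} {q} → ⊛-noZeroDivisors {p} {q}
    }

  X≉0 : ¬ X ≋ []
  X≉0 e = 1≉0 (e .at 1)

  constant-nonzero : ∀ {a} → ¬ a ≈ 0# → ¬ constant a ≋ []
  constant-nonzero a≉0 e = a≉0 (e .at zero)

module Fractions (D : IntegralDomain c ℓ) where
  open IntegralDomain D

  infix 9 _/_⟨_⟩
  record Fraction : Set (c ⊔ ℓ) where
    constructor _/_⟨_⟩
    field
      num   : Carrier
      den   : Carrier
      den≉0 : ¬ den ≈ 0#
  open Fraction public

  infix 4 _≃_
  record _≃_ (x y : Fraction) : Set ℓ where
    constructor mk≃
    field cross : num x * den y ≈ num y * den x
  open _≃_ public

  infixl 6 _⊞_
  infixl 7 _⊠_

  _⊞_ : Fraction → Fraction → Fraction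
  (a / b ⟨ b≉0 ⟩) ⊞ (c / d ⟨ d≉0 ⟩) = (a * d + c * b) / (b * d) ⟨ *-nonzero b≉0 d≉0 ⟩

  _⊠_ : Fraction → Fraction → Fraction
  (a / b ⟨ b≉0 ⟩) ⊠ (c / d ⟨ d≉0 ⟩) = (a * c) / (b * d) ⟨ *-nonzero b≉0 d≉0 ⟩

  ⊟_ : Fraction → Fraction
  ⊟ (a / b ⟨ b≉0 ⟩) = (- a) / b ⟨ b≉0 ⟩

  embed : Carrier → Fraction
  embed a = a / 1# ⟨ 1≉0 ⟩

  private
    module S where
      open RingSolver commutativeSemiring

      swapʳ : ∀ a b c → (a * b) * c ≈ (a * c) * b
      swapʳ = solve 3 (λ a b c → (a :* b) :* c := (a :* c) :* b) refl

      swap₄ : ∀ a b c d → (a * b) * (c * d) ≈ (a * c) * (b * d)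
      swap₄ = solve 4 (λ a b c d → (a :* b) :* (c :* d) := (a :* c) :* (b :* d)) refl

      +-num : ∀ a b c d b′ d′ →
        (a * d + c * b) * (b′ * d′) ≈ (a * b′) * (d * d′) + (c * d′) * (b * b′)
      +-num = solve 6 (λ a b c d b′ d′ →
        (a :* d :+ c :* b) :* (b′ :* d′) :=
        (a :* b′) :* (d :* d′) :+ (c :* d′) :* (b :* b′)) refl

      +-assoc′ : ∀ a b c d e f →
        ((a * d + c * b) * f + e * (b * d)) * (b * (d * f)) ≈
        (a * (d * f) + (c * f + e * d) * b) * (b * d * f)
      +-assoc′ = solve 6 (λ a b c d e f →
        ((a :* d :+ c :* b) :* f :+ e :* (b :* d)) :* (b :* (d :* f)) :=
        (a :* (d :* f) :+ (c :* f :+ e :* d) :* b) :* (b :* d :* f)) refl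

      +-comm′ : ∀ a b c d →
        (a * d + c * b) * (d * b) ≈ (c * b + a * d) * (b * d)
      +-comm′ = solve 4 (λ a b c d →
        (a :* d :+ c :* b) :* (d :* b) :=
        (c :* b :+ a :* d) :* (b :* d)) refl

      *-assoc′ : ∀ a b c d e f →
        (a * c * e) * (b * (d * f)) ≈ (a * (c * e)) * (b * d * f)
      *-assoc′ = solve 6 (λ a b c d e f →
        (a :* c :* e) :* (b :* (d :* f)) :=
        (a :* (c :* e)) :* (b :* d :* f)) refl

      *-comm′ : ∀ a b c d → (a * c) * (d * b) ≈ (c * a) * (b * d)
      *-comm′ = solve 4 (λ a b c d → (a :* c) :* (d :* b) := (c :* a) :* (b :* d)) refl

      distribʳ′ : ∀ a b c d e f →
        (c * f + e * d) * a * (d * b * (f * b)) ≈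
        (c * a * (f * b) + e * a * (d * b)) * (d * f * b)
      distribʳ′ = solve 6 (λ a b c d e f →
        (c :* f :+ e :* d) :* a :* (d :* b :* (f :* b)) :=
        (c :* a :* (f :* b) :+ e :* a :* (d :* b)) :* (d :* f :* b)) refl

  ≃-refl : ∀ {x} → x ≃ x
  ≃-refl = mk≃ refl

  ≃-sym : ∀ {x y} → x ≃ y → y ≃ x
  ≃-sym (mk≃ e) = mk≃ (sym e)

  ≃-trans : ∀ {x y z} → x ≃ y → y ≃ z → x ≃ z
  ≃-trans {a / b ⟨ _ ⟩} {c / d ⟨ d≉0 ⟩} {e / f ⟨ _ ⟩} (mk≃ p) (mk≃ q) =
    mk≃ (*-cancelʳ-nonzero d≉0 (begin
      (a * f) * d  ≈⟨ S.swapʳ a f d ⟩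
      (a * d) * f  ≈⟨ *-congʳ p ⟩
      (c * b) * f  ≈⟨ S.swapʳ c b f ⟩
      (c * f) * b  ≈⟨ *-congʳ q ⟩
      (e * d) * b  ≈⟨ S.swapʳ e d b ⟩
      (e * b) * d  ∎))
    where open SetoidReasoning setoid

  ⊞-cong : Congruent₂ _≃_ _⊞_
  ⊞-cong {a / b ⟨ _ ⟩} {a′ / b′ ⟨ _ ⟩} {c / d ⟨ _ ⟩} {c′ / d′ ⟨ _ ⟩} (mk≃ p) (mk≃ q) = mk≃ (begin
    (a * d + c * b) * (b′ * d′)                ≈⟨ S.+-num a b c d b′ d′ ⟩
    (a * b′) * (d * d′) + (c * d′) * (b * b′)  ≈⟨ +-cong (*-cong p (*-comm d d′)) (*-cong q (*-comm b b′)) ⟩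
    (a′ * b) * (d′ * d) + (c′ * d) * (b′ * b)  ≈⟨ S.+-num a′ b′ c′ d′ b d ⟨
    (a′ * d′ + c′ * b′) * (b * d)              ∎)
    where open SetoidReasoning setoid

  ⊠-cong : Congruent₂ _≃_ _⊠_
  ⊠-cong {a / b ⟨ _ ⟩} {a′ / b′ ⟨ _ ⟩} {c / d ⟨ _ ⟩} {c′ / d′ ⟨ _ ⟩} (mk≃ p) (mk≃ q) = mk≃ (begin
    (a * c) * (b′ * d′)  ≈⟨ S.swap₄ a c b′ d′ ⟩
    (a * b′) * (c * d′)  ≈⟨ *-cong p q ⟩
    (a′ * b) * (c′ * d)  ≈⟨ S.swap₄ a′ b c′ d ⟩
    (a′ * c′) * (b * d)  ∎)
    where open SetoidReasoning setoid

  ⊟-cong : ∀ {x y} → x ≃ y → ⊟ x ≃ ⊟ y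
  ⊟-cong (mk≃ p) =
    mk≃ (trans (sym (-‿distribˡ-* _ _)) (trans (-‿cong p) (-‿distribˡ-* _ _)))

  ⊞-comm : ∀ x y → x ⊞ y ≃ y ⊞ x
  ⊞-comm (a / b ⟨ _ ⟩) (c / d ⟨ _ ⟩) = mk≃ (S.+-comm′ a b c d)

  ⊠-comm : ∀ x y → x ⊠ y ≃ y ⊠ x
  ⊠-comm (a / b ⟨ _ ⟩) (c / d ⟨ _ ⟩) = mk≃ (S.*-comm′ a b c d)

  ⊞-assoc : ∀ x y z → (x ⊞ y) ⊞ z ≃ x ⊞ (y ⊞ z)
  ⊞-assoc (a / b ⟨ _ ⟩) (c / d ⟨ _ ⟩) (e / f ⟨ _ ⟩) = mk≃ (S.+-assoc′ a b c d e f)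

  ⊠-assoc : ∀ x y z → (x ⊠ y) ⊠ z ≃ x ⊠ (y ⊠ z)
  ⊠-assoc (a / b ⟨ _ ⟩) (c / d ⟨ _ ⟩) (e / f ⟨ _ ⟩) = mk≃ (S.*-assoc′ a b c d e f)

  ⊞-identityˡ : LeftIdentity _≃_ (embed 0#) _⊞_
  ⊞-identityˡ (a / b ⟨ _ ⟩) = mk≃ (*-cong
    (trans (+-cong (zeroˡ b) (*-identityʳ a)) (+-identityˡ a)) (sym (*-identityˡ b)))

  ⊠-identityˡ : LeftIdentity _≃_ (embed 1#) _⊠_
  ⊠-identityˡ (a / b ⟨ _ ⟩) = mk≃ (*-cong (*-identityˡ a) (sym (*-identityˡ b)))

  ⊞-inverseˡ : LeftInverse _≃_ (embed 0#) ⊟_ _⊞_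
  ⊞-inverseˡ (a / b ⟨ _ ⟩) = mk≃ (begin
    (- a * b + a * b) * 1#    ≈⟨ *-identityʳ _ ⟩
    - a * b + a * b           ≈⟨ distribʳ b (- a) a ⟨
    (- a + a) * b             ≈⟨ *-congʳ (-‿inverseˡ a) ⟩
    0# * b                    ≈⟨ zeroˡ b ⟩
    0#                        ≈⟨ zeroˡ (b * b) ⟨
    0# * (b * b)              ∎)
    where open SetoidReasoning setoid

  ⊠-distribʳ : ∀ x y z → (y ⊞ z) ⊠ x ≃ (y ⊠ x) ⊞ (z ⊠ x)
  ⊠-distribʳ (a / b ⟨ _ ⟩) (c / d ⟨ _ ⟩) (e / f ⟨ _ ⟩) = mk≃ (S.distribʳ′ a b c d e f)

  fractionRing : CommutativeRing (c ⊔ ℓ) ℓ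
  fractionRing = record
    { Carrier = Fraction
    ; _≈_ = _≃_
    ; _+_ = _⊞_
    ; _*_ = _⊠_
    ; -_  = ⊟_
    ; 0#  = embed 0#
    ; 1#  = embed 1#
    ; isCommutativeRing = record
      { isRing = record
        { +-isAbelianGroup = record
          { isGroup = record
            { isMonoid = record
              { isSemigroup = record
                { isMagma = record
                  { isEquivalence = record
                    { refl = ≃-refl ; sym = ≃-sym ; trans = ≃-trans }
                  ; ∙-cong = ⊞-cong
                  }
                ; assoc = ⊞-assoc
                }
              ; identity =
                  ⊞-identityˡ , λ x → ≃-trans (⊞-comm x (embed 0#)) (⊞-identityˡ x)
              }
            ; inverse = ⊞-inverseˡ , λ x → ≃-trans (⊞-comm x (⊟ x)) (⊞-inverseˡ x)
            ; ⁻¹-cong = ⊟-cong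
            }
          ; comm = ⊞-comm
          }
        ; *-cong = ⊠-cong
        ; *-assoc = ⊠-assoc
        ; *-identity =
            ⊠-identityˡ , λ x → ≃-trans (⊠-comm x (embed 1#)) (⊠-identityˡ x)
        ; distrib =
            (λ x y z → ≃-trans (⊠-comm x (y ⊞ z))
              (≃-trans (⊠-distribʳ x y z) (⊞-cong (⊠-comm y x) (⊠-comm z x))))
            , ⊠-distribʳ
        }
      ; *-comm = ⊠-comm
      }
    }

  _⁻¹⟨_⟩ : ∀ x → ¬ x ≃ embed 0# → Fraction
  (a / b ⟨ _ ⟩) ⁻¹⟨ x≄0 ⟩ =
    b / a ⟨ (λ a≈0 → x≄0 (mk≃ (trans (*-identityʳ a) (trans a≈0 (sym (zeroˡ b)))))) ⟩

  ⁻¹-inverse : ∀ x (x≄0 : ¬ x ≃ embed 0#) → x ⊠ x ⁻¹⟨ x≄0 ⟩ ≃ embed 1#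
  ⁻¹-inverse (a / b ⟨ _ ⟩) x≄0 =
    mk≃ (trans (*-identityʳ (a * b)) (trans (*-comm a b) (sym (*-identityˡ (b * a)))))

rationals : IntegralDomain _ _
rationals = record
  { commutativeRing = ℚ.+-*-commutativeRing
  ; 1≉0            = λ ()
  ; zero?          = ℚ._≟ 0ℚ
  ; noZeroDivisors = noZeroDivisors
  }
  where
  noZeroDivisors : ∀ {p q} → p ℚ.* q ≡ 0ℚ → p ≡ 0ℚ ⊎ q ≡ 0ℚ
  noZeroDivisors {p} {q} pq≡0 with p ℚ.≟ 0ℚ
  ... | yes p≡0 = inj₁ p≡0
  ... | no  p≢0 = inj₂ (begin
      q                        ≡⟨ ℚ.*-identityˡ q ⟨
      ℚ.1ℚ ℚ.* q               ≡⟨ ≡.cong (ℚ._* q) (ℚ.*-inverseˡ p) ⟨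
      ((ℚ.1/ p) ℚ.* p) ℚ.* q   ≡⟨ ℚ.*-assoc (ℚ.1/ p) p q ⟩
      (ℚ.1/ p) ℚ.* (p ℚ.* q)   ≡⟨ ≡.cong ((ℚ.1/ p) ℚ.*_) pq≡0 ⟩
      (ℚ.1/ p) ℚ.* 0ℚ          ≡⟨ ℚ.*-zeroʳ (ℚ.1/ p) ⟩
      0ℚ                       ∎)
    where
    open ≡.≡-Reasoning
    instance nz = ℚ.≢-nonZero p≢0

module ℚ[x₁] = Polynomial rationals
module ℚ[x₁][x₂] = Polynomial ℚ[x₁].polynomials

ℚ[x₁,x₂] : IntegralDomain _ _
ℚ[x₁,x₂] = ℚ[x₁][x₂].polynomials

module Pol = IntegralDomain ℚ[x₁,x₂]

X₁ X₂ : Pol.Carrier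
X₁ = ℚ[x₁][x₂].constant ℚ[x₁].X
X₂ = ℚ[x₁][x₂].X

X₁≉0 : ¬ X₁ Pol.≈ Pol.0#
X₁≉0 = ℚ[x₁][x₂].constant-nonzero ℚ[x₁].X≉0

X₂≉0 : ¬ X₂ Pol.≈ Pol.0#
X₂≉0 = ℚ[x₁][x₂].X≉0

open Fractions ℚ[x₁,x₂] public using (Fraction; _/_⟨_⟩; num; den; den≉0; embed)

ℚ⟨x₁,x₂⟩ : CommutativeRing _ _
ℚ⟨x₁,x₂⟩ = Fractions.fractionRing ℚ[x₁,x₂]

module Rat where
  open CommutativeRing ℚ⟨x₁,x₂⟩ public
  open Exp semiring public using (_^_)

record WeightedGraph (A : Set) : Set₁ where
  field
    Vertex Edge       : Set
    _≟_               : DecidableEquality Vertex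
    vertices          : List Vertex
    vertices-complete : ∀ v → v ∈ vertices
    edges             : List Edge
    edges-complete    : ∀ e → e ∈ edges
    edges-unique      : Unique edges
    ends              : Edge → Vertex × Vertex
    weight            : Edge → A

  _∈ᵉ_ : Vertex → Edge → Set
  v ∈ᵉ e = v ≡ proj₁ (ends e) ⊎ v ≡ proj₂ (ends e)

  _∈ᵉ?_ : ∀ v e → Dec (v ∈ᵉ e)
  v ∈ᵉ? e = (v ≟ proj₁ (ends e)) ⊎-dec (v ≟ proj₂ (ends e))

  -- Sets of edges are represented by the sublists of the duplicate-free list edges.
  IsPerfectMatching : List Edge → Set
  IsPerfectMatching S = ∀ v → length (filter (v ∈ᵉ?_) S) ≡ 1

  isPerfectMatching? : ∀ S → Dec (IsPerfectMatching S)
  isPerfectMatching? S =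
    map′ (λ all v → All.lookup all (vertices-complete v)) (λ f → All.tabulate (λ {v} _ → f v))
         (All.all? (λ v → length (filter (v ∈ᵉ?_) S) ℕ.≟ 1) vertices)

sublists : {A : Set} → List A → List (List A)
sublists []       = [] ∷ []
sublists (x ∷ xs) = sublists xs ++ map (x ∷_) (sublists xs)

module _ (G : WeightedGraph Pol.Carrier) where
  open WeightedGraph G

  perfectMatchings : List (List Edge)
  perfectMatchings = filter isPerfectMatching? (sublists edges)

  setWeight : List Edge → Pol.Carrier
  setWeight S = foldr Pol._*_ Pol.1# (map weight S)

  matchingSum : Pol.Carrier
  matchingSum = foldr Pol._+_ Pol.0# (map setWeight perfectMatchings)

-- Columns are numbered from 0 in Fin m; horizontal r j joins columns j and j + 1 in row r.
data GridEdge : ℕ → Set where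
  vertical   : ∀ {m} → Fin m → GridEdge m
  horizontal : ∀ {m} → Fin 2 → Fin m → GridEdge (suc m)

shift : ∀ {m} → GridEdge m → GridEdge (suc m)
shift (vertical j)     = vertical (suc j)
shift (horizontal r j) = horizontal r (suc j)

gridEdges : ∀ m → List (GridEdge m)
gridEdges 0             = []
gridEdges 1             = vertical zero ∷ []
gridEdges (suc (suc m)) =
  vertical zero ∷ horizontal zero zero ∷ horizontal (suc zero) zero ∷
  map shift (gridEdges (suc m))

private
  gridEdges-complete : ∀ {m} (e : GridEdge m) → e ∈ gridEdges m
  gridEdges-complete {1}           (vertical zero)    = here ≡.refl
  gridEdges-complete {suc (suc m)} (vertical zero)    = here ≡.refl
  gridEdges-complete {suc (suc m)} (vertical (suc j)) =
    there (there (there (∈-map⁺ shift (gridEdges-complete (vertical j)))))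
  gridEdges-complete {suc (suc m)} (horizontal zero       zero) = there (here ≡.refl)
  gridEdges-complete {suc (suc m)} (horizontal (suc zero) zero) = there (there (here ≡.refl))
  gridEdges-complete {suc (suc m)} (horizontal r (suc j)) =
    there (there (there (∈-map⁺ shift (gridEdges-complete (horizontal r j)))))

  shift-injective : ∀ {m} {e f : GridEdge m} → shift e ≡ shift f → e ≡ f
  shift-injective {e = vertical _}     {vertical _}     ≡.refl = ≡.refl
  shift-injective {e = horizontal _ _} {horizontal _ _} ≡.refl = ≡.refl

  fresh : ∀ {m} {e : GridEdge (suc m)} → (∀ f → e ≢ shift f) →
          ∀ es → All (e ≢_) (map shift es)
  fresh e≢ []       = []
  fresh e≢ (f ∷ es) = e≢ f ∷ fresh e≢ es

  gridEdges-unique : ∀ m → Unique (gridEdges m)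
  gridEdges-unique 0             = []
  gridEdges-unique 1             = [] ∷ []
  gridEdges-unique (suc (suc m)) =
    ((λ ()) ∷ (λ ()) ∷ fresh (λ { (vertical _) () ; (horizontal _ _) () }) es) ∷
    ((λ ()) ∷ fresh (λ { (vertical _) () ; (horizontal _ _) () }) es) ∷
    fresh (λ { (vertical _) () ; (horizontal _ _) () }) es ∷
    map⁺ shift-injective (gridEdges-unique (suc m))
    where es = gridEdges (suc m)

gridEnds : ∀ {m} → GridEdge m → (Fin 2 × Fin m) × (Fin 2 × Fin m)
gridEnds (vertical j)     = (zero , j) , (suc zero , j)
gridEnds (horizontal r j) = (r , inject₁ j) , (r , suc j)

module _ (x₁ x₂ : Pol.Carrier) where

  columnWeight : Parity → Pol.Carrier
  columnWeight 1ℙ = x₂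
  columnWeight 0ℙ = x₁

  -- suc (toℕ j) is the number of column j when columns are counted from 1.
  gridWeight : ∀ {m} → GridEdge m → Pol.Carrier
  gridWeight (vertical _)     = Pol.1#
  gridWeight (horizontal _ j) = columnWeight (ℕ.parity (suc (toℕ j)))

  H : ℕ → WeightedGraph Pol.Carrier
  H m = record
    { Vertex            = Fin 2 × Fin m
    ; Edge              = GridEdge m
    ; _≟_               = ≡-dec Fin._≟_ Fin._≟_
    ; vertices          = cartesianProduct (allFin 2) (allFin m)
    ; vertices-complete = λ (r , j) → ∈-cartesianProduct⁺ (∈-allFin r) (∈-allFin j)
    ; edges             = gridEdges m
    ; edges-complete    = gridEdges-complete
    ; edges-unique      = gridEdges-unique m
    ; ends              = gridEnds
    ; weight            = gridWeight
    }

-- G, p and m take junk values at n = 1 and n = 2, where the paper leaves them undefined.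

G⁺ : Pol.Carrier → Pol.Carrier → ℕ → WeightedGraph Pol.Carrier
G⁺ x₁ x₂ n = H x₁ x₂ (2 ℕ.* n ∸ 4)

m⁺ : Pol.Carrier → Pol.Carrier → ℕ → Pol.Carrier
m⁺ x₁ x₂ n = x₁ Pol.^ (n ∸ 2) Pol.* x₂ Pol.^ (n ∸ 3)

G : ℤ → WeightedGraph Pol.Carrier
G n = if n ≤ᵇ 0ℤ then G⁺ X₂ X₁ ∣ ℤ.+ 3 ℤ.- n ∣ else G⁺ X₁ X₂ ∣ n ∣

p : ℤ → Pol.Carrier
p n = matchingSum (G n)

m : ℤ → Pol.Carrier
m n = if n ≤ᵇ 0ℤ then m⁺ X₂ X₁ ∣ ℤ.+ 3 ℤ.- n ∣ else m⁺ X₁ X₂ ∣ n ∣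

m≉0 : ∀ n → ¬ m n Pol.≈ Pol.0#
m≉0 n with n ≤ᵇ 0ℤ
... | true  =
  Pol.*-nonzero (Pol.^-nonzero (∣ ℤ.+ 3 ℤ.- n ∣ ∸ 2) X₂≉0)
                (Pol.^-nonzero (∣ ℤ.+ 3 ℤ.- n ∣ ∸ 3) X₁≉0)
... | false =
  Pol.*-nonzero (Pol.^-nonzero (∣ n ∣ ∸ 2) X₁≉0) (Pol.^-nonzero (∣ n ∣ ∸ 3) X₂≉0)

record IsClusterSequence (x : ℤ → Fraction) : Set where
  open Rat
  field
    x₁         : x (ℤ.+ 1) ≈ embed X₁
    x₂         : x (ℤ.+ 2) ≈ embed X₂
    recurrence : ∀ n → x n * x (n ℤ.- ℤ.+ 2) ≈ x (n ℤ.- ℤ.+ 1) ^ 2 + 1#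

module Submission where

-- Removing the first column of the 2 × k grid leaves either the rest, when its vertical edge is
-- used, or, when both horizontal edges are used, the grid without two columns; removing one
-- column interchanges the weights.  Hence the matching sums Z satisfy
-- Z a b (2 + k) = Z b a (1 + k) + b² Z a b k.  Along even k this is a linear recurrence of
-- order two, P (2 + k) + a²b² P k = (1 + a² + b²) P (1 + k), so P (2 + k) P k − P (1 + k)² is
-- multiplied by a²b² when k grows by one: it is the square of the denominator monomial, which is
-- the cluster recurrence for the quotients.  The recurrence determines x, because
-- the quotients do not vanish: every Z has constant term 1.  For n ≤ 0 the same argument
-- applies to k ↦ x (2 − k), whose initial values are interchanged.

open import Defs
open import Data.Integer.Base using (ℤ; +_)
open import Relation.Binary.PropositionalEquality using (_≢_)

open import Level using (Level; 0ℓ)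
open import Algebra.Bundles using (CommutativeRing)
import Algebra.Properties.Group as GroupProperties
import Algebra.Properties.Semiring.Exp as Exp
import Algebra.Solver.Ring.NaturalCoefficients.Default as RingSolver
open import Data.Bool.Base using (true; false)
open import Data.Fin.Base using (Fin; zero; suc; toℕ)
open import Data.Integer.Base as ℤ using (-[1+_])
import Data.Integer.Properties as ℤ
open import Data.List.Base using (List; []; _∷_; _++_; map; foldr; filter; length)
open import Data.List.Properties
  using (map-++; map-∘; map-cong; length-map; filter-++; filter-≐; filter-none)
import Data.List.Relation.Unary.All as All
import Data.List.Relation.Unary.All.Properties as All
open import Data.Nat.Base as ℕ using (ℕ; zero; suc)
import Data.Nat.Properties as ℕ
open import Data.Parity.Base using (0ℙ; 1ℙ; _⁻¹)
import Data.Parity.Properties as ℙ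
open import Data.Product.Base using (_×_; _,_; proj₁)
import Data.Rational.Base as ℚ
import Data.Rational.Properties as ℚ
open import Data.Sum.Base using (inj₁; inj₂)
open import Function.Base using (_∘_)
open import Relation.Binary.PropositionalEquality as ≡ using (_≡_)
import Relation.Binary.Reasoning.Setoid as SetoidReasoning
open import Relation.Nullary.Decidable using (does)
open import Relation.Nullary.Negation using (¬_; contradiction)
open import Relation.Unary using (Pred; Decidable; _≐_)

private variable
  c ℓ : Level
  A B : Set

-- Sublists and filters under `map`

sublists-map : ∀ (f : A → B) xs → sublists (map f xs) ≡ map (map f) (sublists xs)
sublists-map f []       = ≡.refl
sublists-map f (x ∷ xs) = begin
  sublists (map f xs) ++ map (f x ∷_) (sublists (map f xs))
    ≡⟨ ≡.cong (λ ys → ys ++ map (f x ∷_) ys) (sublists-map f xs) ⟩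
  map (map f) ys ++ map (f x ∷_) (map (map f) ys)
    ≡⟨ ≡.cong (map (map f) ys ++_) (≡.trans (≡.sym (map-∘ ys)) (map-∘ ys)) ⟩
  map (map f) ys ++ map (map f) (map (x ∷_) ys)
    ≡⟨ map-++ (map f) ys (map (x ∷_) ys) ⟨
  map (map f) (ys ++ map (x ∷_) ys)  ∎
  where
  open ≡.≡-Reasoning
  ys = sublists xs

filter-map : ∀ {P : Pred B 0ℓ} (P? : Decidable P) (f : A → B) xs →
             filter P? (map f xs) ≡ map f (filter (P? ∘ f) xs)
filter-map P? f []       = ≡.refl
filter-map P? f (x ∷ xs) with does (P? (f x))
... | true  = ≡.cong (f x ∷_) (filter-map P? f xs)
... | false = filter-map P? f xs

-- Weighted sums over the sublists that satisfy a predicate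

module SublistSum (R : CommutativeRing c ℓ) where
  open CommutativeRing R hiding (zero)

  setProduct : (A → Carrier) → List A → Carrier
  setProduct w S = foldr _*_ 1# (map w S)

  -- `matchingSum` unfolds to an instance of this sum. The predicate is a parameter so that, once an
  -- edge has been chosen, the condition on the remaining edges is again of the same kind: `P?`
  -- composed with `x ∷_`.
  sublistSum : (A → Carrier) → {P : Pred (List A) 0ℓ} → Decidable P →
               List A → Carrier
  sublistSum w P? xs = foldr _+_ 0# (map (setProduct w) (filter P? (sublists xs)))

  private
    sum : List Carrier → Carrier
    sum = foldr _+_ 0#

    sum-++ : ∀ xs ys → sum (xs ++ ys) ≈ sum xs + sum ys
    sum-++ []       ys = sym (+-identityˡ _)
    sum-++ (x ∷ xs) ys = trans (+-congˡ (sum-++ xs ys)) (sym (+-assoc _ _ _))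

    sum-*ˡ : ∀ a (f : A → Carrier) xs → sum (map (λ x → a * f x) xs) ≈ a * sum (map f xs)
    sum-*ˡ a f []       = sym (zeroʳ a)
    sum-*ˡ a f (x ∷ xs) = trans (+-congˡ (sum-*ˡ a f xs)) (sym (distribˡ a _ _))

  sublistSum-none : ∀ (w : A → Carrier) {P : Pred (List A) 0ℓ} (P? : Decidable P) →
    (∀ S → ¬ P S) → ∀ xs → sublistSum w P? xs ≡ 0#
  sublistSum-none w P? ¬P xs =
    ≡.cong (sum ∘ map (setProduct w)) (filter-none P? (All.universal ¬P (sublists xs)))

  module _ (w : A → Carrier) {P : Pred (List A) 0ℓ} (P? : Decidable P) where

    -- The sublists are split by whether they use `x`; those that do share the factor `w x`.
    sublistSum-∷ : ∀ x xs →
      sublistSum w P? (x ∷ xs) ≈ sublistSum w P? xs + w x * sublistSum w (P? ∘ (x ∷_)) xs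
    sublistSum-∷ x xs = begin
      sum (map W (filter P? (ys ++ map (x ∷_) ys)))
        ≡⟨ ≡.cong (sum ∘ map W) (filter-++ P? ys _) ⟩
      sum (map W (filter P? ys ++ filter P? (map (x ∷_) ys)))
        ≡⟨ ≡.cong sum (map-++ W (filter P? ys) _) ⟩
      sum (map W (filter P? ys) ++ map W (filter P? (map (x ∷_) ys)))
        ≈⟨ sum-++ (map W (filter P? ys)) _ ⟩
      sum (map W (filter P? ys)) + sum (map W (filter P? (map (x ∷_) ys)))
        ≡⟨ ≡.cong (λ zs → sum (map W (filter P? ys)) + sum (map W zs)) (filter-map P? (x ∷_) ys) ⟩
      sum (map W (filter P? ys)) + sum (map W (map (x ∷_) zs))
        ≡⟨ ≡.cong (λ us → sum (map W (filter P? ys)) + sum us) (map-∘ zs) ⟨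
      sum (map W (filter P? ys)) + sum (map (λ S → w x * W S) zs)
        ≈⟨ +-congˡ (sum-*ˡ (w x) W zs) ⟩
      sum (map W (filter P? ys)) + w x * sum (map W zs)  ∎
      where
      open SetoidReasoning setoid
      W  = setProduct w
      ys = sublists xs
      zs = filter (P? ∘ (x ∷_)) ys

    sublistSum-map : ∀ (f : B → A) xs →
      sublistSum w P? (map f xs) ≡ sublistSum (w ∘ f) (P? ∘ map f) xs
    sublistSum-map f xs = begin
      sum (map W (filter P? (sublists (map f xs))))
        ≡⟨ ≡.cong (sum ∘ map W ∘ filter P?) (sublists-map f xs) ⟩
      sum (map W (filter P? (map (map f) (sublists xs))))
        ≡⟨ ≡.cong (sum ∘ map W) (filter-map P? (map f) (sublists xs)) ⟩
      sum (map W (map (map f) zs))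
        ≡⟨ ≡.cong sum (map-∘ zs) ⟨
      sum (map (W ∘ map f) zs)
        ≡⟨ ≡.cong sum (map-cong (λ S → ≡.cong (foldr _*_ 1#) (≡.sym (map-∘ S))) zs) ⟩
      sum (map (setProduct (w ∘ f)) zs)  ∎
      where
      open ≡.≡-Reasoning
      W  = setProduct w
      zs = filter (P? ∘ map f) (sublists xs)

    sublistSum-drop : ∀ x → (∀ S → ¬ P (x ∷ S)) → ∀ xs →
      sublistSum w P? (x ∷ xs) ≈ sublistSum w P? xs
    sublistSum-drop x ¬P xs = begin
      sublistSum w P? (x ∷ xs)
        ≈⟨ sublistSum-∷ x xs ⟩
      sublistSum w P? xs + w x * sublistSum w (P? ∘ (x ∷_)) xs
        ≡⟨ ≡.cong (λ s → sublistSum w P? xs + w x * s) (sublistSum-none w (P? ∘ (x ∷_)) ¬P xs) ⟩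
      sublistSum w P? xs + w x * 0#
        ≈⟨ +-congˡ (zeroʳ (w x)) ⟩
      sublistSum w P? xs + 0#
        ≈⟨ +-identityʳ _ ⟩
      sublistSum w P? xs  ∎
      where open SetoidReasoning setoid

    -- The case of a forced `x`: the sublists avoiding it contribute nothing.
    sublistSum-take : ∀ x xs → sublistSum w P? xs ≈ 0# →
      sublistSum w P? (x ∷ xs) ≈ w x * sublistSum w (P? ∘ (x ∷_)) xs
    sublistSum-take x xs Σ≈0 =
      trans (sublistSum-∷ x xs) (trans (+-congʳ Σ≈0) (+-identityˡ _))

    sublistSum-map-none : ∀ (f : B → A) → (∀ S → ¬ P (map f S)) → ∀ xs →
      sublistSum w P? (map f xs) ≈ 0#
    sublistSum-map-none f ¬P xs =
      reflexive (≡.trans (sublistSum-map f xs) (sublistSum-none (w ∘ f) (P? ∘ map f) ¬P xs))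

  sublistSum-cong : ∀ {v w : A → Carrier} → (∀ x → v x ≡ w x) →
    ∀ {P Q : Pred (List A) 0ℓ} (P? : Decidable P) (Q? : Decidable Q) → P ≐ Q →
    ∀ xs → sublistSum v P? xs ≡ sublistSum w Q? xs
  sublistSum-cong v≗w P? Q? P≐Q xs = ≡.trans
    (≡.cong sum (map-cong (λ S → ≡.cong (foldr _*_ 1#) (map-cong v≗w S)) (filter P? (sublists xs))))
    (≡.cong (sum ∘ map (setProduct _)) (filter-≐ P? Q? P≐Q (sublists xs)))

-- Perfect matchings of the grid, by the edges at its first column

module Grid where
  open Pol
  open SublistSum Pol.commutativeRing

  private variable
    k : ℕ

  private
    pattern v₀    = vertical zero
    pattern h₀    = horizontal zero zero
    pattern h₁    = horizontal (suc zero) zero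
    pattern row₀  = zero
    pattern row₁  = suc zero

  module _ (a b : Carrier) {k : ℕ} where
    open WeightedGraph (H a b k) public using (_∈ᵉ_; _∈ᵉ?_; IsPerfectMatching; isPerfectMatching?)

    degree : Fin 2 × Fin k → List (GridEdge k) → ℕ
    degree v S = length (filter (_∈ᵉ?_ v) S)

  columnWeight-⁻¹ : ∀ a b p → columnWeight a b (p ⁻¹) ≡ columnWeight b a p
  columnWeight-⁻¹ a b 0ℙ = ≡.refl
  columnWeight-⁻¹ a b 1ℙ = ≡.refl

  -- A shift raises the column number by one and so flips its parity. This is what makes the two
  -- weights alternate in the recursion.
  gridWeight-shift : ∀ a b (e : GridEdge k) → gridWeight a b (shift e) ≡ gridWeight b a e
  gridWeight-shift a b (vertical _)     = ≡.refl
  gridWeight-shift a b (horizontal _ j) = ≡.trans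
    (≡.cong (columnWeight a b) (≡.sym (ℙ.suc-homo-⁻¹ (toℕ j))))
    (columnWeight-⁻¹ a b (ℕ.parity (suc (toℕ j))))

  module _ (a b : Carrier) where

    ∈ᵉ-shift : ∀ r (j : Fin k) →
      (λ e → _∈ᵉ_ a b (r , suc j) (shift e)) ≐ _∈ᵉ_ b a (r , j)
    ∈ᵉ-shift r j = (λ {e} → to e) , (λ {e} → from e)
      where
      to : ∀ e → _∈ᵉ_ a b (r , suc j) (shift e) → _∈ᵉ_ b a (r , j) e
      to (vertical _)     (inj₁ ≡.refl) = inj₁ ≡.refl
      to (vertical _)     (inj₂ ≡.refl) = inj₂ ≡.refl
      to (horizontal _ _) (inj₁ ≡.refl) = inj₁ ≡.refl
      to (horizontal _ _) (inj₂ ≡.refl) = inj₂ ≡.refl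
      from : ∀ e → _∈ᵉ_ b a (r , j) e → _∈ᵉ_ a b (r , suc j) (shift e)
      from (vertical _)     (inj₁ ≡.refl) = inj₁ ≡.refl
      from (vertical _)     (inj₂ ≡.refl) = inj₂ ≡.refl
      from (horizontal _ _) (inj₁ ≡.refl) = inj₁ ≡.refl
      from (horizontal _ _) (inj₂ ≡.refl) = inj₂ ≡.refl

    degree-shift : ∀ r (j : Fin k) S →
      degree a b (r , suc j) (map shift S) ≡ degree b a (r , j) S
    degree-shift r j S = begin
      length (filter P? (map shift S))          ≡⟨ ≡.cong length (filter-map P? shift S) ⟩
      length (map shift (filter (P? ∘ shift) S)) ≡⟨ length-map shift (filter (P? ∘ shift) S) ⟩
      length (filter (P? ∘ shift) S)
        ≡⟨ ≡.cong length (filter-≐ (P? ∘ shift) (_∈ᵉ?_ b a (r , j)) (∈ᵉ-shift r j) S) ⟩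
      degree b a (r , j) S  ∎
      where
      open ≡.≡-Reasoning
      P? = _∈ᵉ?_ a b (r , suc j)

    degree-shift-zero : ∀ r (S : List (GridEdge k)) → degree a b (r , zero) (map shift S) ≡ 0
    degree-shift-zero r S = ≡.cong length (filter-none (_∈ᵉ?_ a b (r , zero))
      (All.map⁺ (All.universal ∉shift S)))
      where
      ∉shift : ∀ e → ¬ _∈ᵉ_ a b (r , zero) (shift e)
      ∉shift (vertical _)     (inj₁ ())
      ∉shift (vertical _)     (inj₂ ())
      ∉shift (horizontal _ _) (inj₁ ())
      ∉shift (horizontal _ _) (inj₂ ())

  module _ (a b : Carrier) where

    private
      PM : List (GridEdge k) → Set
      PM = IsPerfectMatching a b

    -- Shifted edges miss column zero, so `v₀` alone covers its two vertices; every later vertex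
    -- keeps the degree it had before the shift.
    vertical-first : (λ S → PM (v₀ ∷ map shift S)) ≐ IsPerfectMatching b a {k}
    vertical-first = to , from
      where
      to : ∀ {S} → PM (v₀ ∷ map shift S) → IsPerfectMatching b a S
      to {S} pm (row₀ , j) = ≡.trans (≡.sym (degree-shift a b row₀ j S)) (pm (row₀ , suc j))
      to {S} pm (row₁ , j) = ≡.trans (≡.sym (degree-shift a b row₁ j S)) (pm (row₁ , suc j))
      from : ∀ {S} → IsPerfectMatching b a S → PM (v₀ ∷ map shift S)
      from {S} pm (row₀ , zero)  = ≡.cong suc (degree-shift-zero a b row₀ S)
      from {S} pm (row₁ , zero)  = ≡.cong suc (degree-shift-zero a b row₁ S)
      from {S} pm (row₀ , suc j) = ≡.trans (degree-shift a b row₀ j S) (pm (row₀ , j))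
      from {S} pm (row₁ , suc j) = ≡.trans (degree-shift a b row₁ j S) (pm (row₁ , j))

    -- The two edges cover columns zero and one exactly once, and edges shifted twice miss both
    -- columns. The condition that remains concerns the later columns only.
    horizontals-first :
      (λ S → PM (h₀ ∷ h₁ ∷ map shift (map shift S))) ≐
      PM {k}
    horizontals-first = to , from
      where
      degree-shift² : ∀ r (j : Fin k) S →
        degree a b (r , suc (suc j)) (map shift (map shift S)) ≡ degree a b (r , j) S
      degree-shift² r j S =
        ≡.trans (degree-shift a b r (suc j) (map shift S)) (degree-shift b a r j S)
      degree-one : ∀ r (S : List (GridEdge k)) →
        degree a b (r , suc zero) (map shift (map shift S)) ≡ 0
      degree-one r S = ≡.trans (degree-shift a b r zero (map shift S)) (degree-shift-zero b a r S)
      to : ∀ {S} → PM (h₀ ∷ h₁ ∷ map shift (map shift S)) → PM S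
      to {S} pm (row₀ , j) = ≡.trans (≡.sym (degree-shift² row₀ j S)) (pm (row₀ , suc (suc j)))
      to {S} pm (row₁ , j) = ≡.trans (≡.sym (degree-shift² row₁ j S)) (pm (row₁ , suc (suc j)))
      from : ∀ {S} → PM S → PM (h₀ ∷ h₁ ∷ map shift (map shift S))
      from {S} pm (row₀ , zero)        = ≡.cong suc (degree-shift-zero a b row₀ (map shift S))
      from {S} pm (row₁ , zero)        = ≡.cong suc (degree-shift-zero a b row₁ (map shift S))
      from {S} pm (row₀ , suc zero)    = ≡.cong suc (degree-one row₀ S)
      from {S} pm (row₁ , suc zero)    = ≡.cong suc (degree-one row₁ S)
      from {S} pm (row₀ , suc (suc j)) = ≡.trans (degree-shift² row₀ j S) (pm (row₀ , j))
      from {S} pm (row₁ , suc (suc j)) = ≡.trans (degree-shift² row₁ j S) (pm (row₁ , j))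

    private
      PM? : Decidable (PM {k})
      PM? = isPerfectMatching? a b

      w : GridEdge k → Carrier
      w = gridWeight a b

      2≢1 : ∀ {n} → ¬ suc (suc n) ≡ 1
      2≢1 ()

      uncovered : ∀ {r} (S : List (GridEdge k)) → ¬ degree a b (r , zero) (map shift S) ≡ 1
      uncovered {r = r} S deg≡1 with ≡.trans (≡.sym (degree-shift-zero a b r S)) deg≡1
      ... | ()

      vertical-sum : ∀ k →
        sublistSum w (PM? ∘ (v₀ ∷_)) (h₀ ∷ h₁ ∷ map shift (gridEdges (suc k))) ≈
        matchingSum (H b a (suc k))
      vertical-sum k = begin
        sublistSum w (PM? ∘ (v₀ ∷_)) (h₀ ∷ h₁ ∷ map shift es)
          -- Next to `v₀`, each of `h₀` and `h₁` would cover a vertex of column zero twice.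
          ≈⟨ sublistSum-drop w (PM? ∘ (v₀ ∷_)) h₀ (λ S pm → 2≢1 (pm (row₀ , zero)))
               (h₁ ∷ map shift es) ⟩
        sublistSum w (PM? ∘ (v₀ ∷_)) (h₁ ∷ map shift es)
          ≈⟨ sublistSum-drop w (PM? ∘ (v₀ ∷_)) h₁ (λ S pm → 2≢1 (pm (row₁ , zero)))
               (map shift es) ⟩
        sublistSum w (PM? ∘ (v₀ ∷_)) (map shift es)
          ≡⟨ sublistSum-map w (PM? ∘ (v₀ ∷_)) shift es ⟩
        sublistSum (w ∘ shift) (PM? ∘ (v₀ ∷_) ∘ map shift) es
          ≡⟨ sublistSum-cong (gridWeight-shift a b) _ (isPerfectMatching? b a) vertical-first es ⟩
        matchingSum (H b a (suc k))  ∎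
        where
        open SetoidReasoning setoid
        es = gridEdges (suc k)

      both : Decidable (λ S → PM {suc (suc k)} (h₀ ∷ h₁ ∷ S))
      both S = PM? (h₀ ∷ h₁ ∷ S)

      horizontal-sum : ∀ k → sublistSum w both (map shift (gridEdges (suc k))) ≈
                       matchingSum (H a b k)
      -- Both sums compute: the vertical edge of column one is excluded by `h₀`, which leaves the
      -- empty set, the only matching of the empty grid.
      horizontal-sum zero    = refl
      horizontal-sum (suc k) = begin
        sublistSum w both (map shift (v₀ ∷ h₀ ∷ h₁ ∷ map shift es))
          -- Column one is already covered by `h₀` and `h₁`, so the three edges that start there are
          -- excluded in turn.
          ≈⟨ sublistSum-drop w both (shift v₀) (λ S pm → 2≢1 (pm (row₀ , suc zero)))
               (map shift (h₀ ∷ h₁ ∷ map shift es)) ⟩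
        sublistSum w both (map shift (h₀ ∷ h₁ ∷ map shift es))
          ≈⟨ sublistSum-drop w both (shift h₀) (λ S pm → 2≢1 (pm (row₀ , suc zero)))
               (map shift (h₁ ∷ map shift es)) ⟩
        sublistSum w both (map shift (h₁ ∷ map shift es))
          ≈⟨ sublistSum-drop w both (shift h₁) (λ S pm → 2≢1 (pm (row₁ , suc zero)))
               (map shift (map shift es)) ⟩
        sublistSum w both (map shift (map shift es))
          ≡⟨ sublistSum-map w both shift (map shift es) ⟩
        sublistSum (w ∘ shift) (both ∘ map shift) (map shift es)
          ≡⟨ sublistSum-map (w ∘ shift) (both ∘ map shift) shift es ⟩
        sublistSum (w ∘ shift ∘ shift) (both ∘ map shift ∘ map shift) es
          ≡⟨ sublistSum-cong
               (λ e → ≡.trans (gridWeight-shift a b (shift e)) (gridWeight-shift b a e))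
               _ PM? horizontals-first es ⟩
        matchingSum (H a b (suc k))  ∎
        where
        open SetoidReasoning setoid
        es = gridEdges (suc k)

    matchingSum-grid : ∀ k → matchingSum (H a b (suc (suc k))) ≈
      matchingSum (H b a (suc k)) + b * b * matchingSum (H a b k)
    matchingSum-grid k = begin
      sublistSum w PM? (v₀ ∷ h₀ ∷ h₁ ∷ es)
        ≈⟨ sublistSum-∷ w PM? v₀ (h₀ ∷ h₁ ∷ es) ⟩
      sublistSum w PM? (h₀ ∷ h₁ ∷ es) + 1# * sublistSum w (PM? ∘ (v₀ ∷_)) (h₀ ∷ h₁ ∷ es)
        ≈⟨ +-cong no-vertical (trans (*-identityˡ _) (vertical-sum k)) ⟩
      b * b * matchingSum (H a b k) + matchingSum (H b a (suc k))
        ≈⟨ +-comm (b * b * matchingSum (H a b k)) (matchingSum (H b a (suc k))) ⟩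
      matchingSum (H b a (suc k)) + b * b * matchingSum (H a b k)  ∎
      where
      open SetoidReasoning setoid
      es = map shift (gridEdges (suc k))
      -- Without `v₀` and `h₀` the vertex of column zero in `row₀` stays uncovered, whether or not
      -- `h₁` is used.
      no-top : sublistSum w PM? (h₁ ∷ es) ≈ 0#
      no-top = begin
        sublistSum w PM? (h₁ ∷ es)
          ≈⟨ sublistSum-take w PM? h₁ es (sublistSum-map-none w PM? shift
               (λ S pm → uncovered S (pm (row₀ , zero))) (gridEdges (suc k))) ⟩
        b * sublistSum w (PM? ∘ (h₁ ∷_)) es
          ≈⟨ *-congˡ {b} (sublistSum-map-none w (PM? ∘ (h₁ ∷_)) shift
               (λ S pm → uncovered S (pm (row₀ , zero))) (gridEdges (suc k))) ⟩
        b * 0#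
          ≈⟨ zeroʳ b ⟩
        0#  ∎
      -- Without `v₀`, first `h₀` and then `h₁` is forced. Both join columns number one and two,
      -- counted from one, so each contributes the odd weight `b`.
      no-vertical : sublistSum w PM? (h₀ ∷ h₁ ∷ es) ≈ b * b * matchingSum (H a b k)
      no-vertical = begin
        sublistSum w PM? (h₀ ∷ h₁ ∷ es)
          ≈⟨ sublistSum-take w PM? h₀ (h₁ ∷ es) no-top ⟩
        b * sublistSum w (PM? ∘ (h₀ ∷_)) (h₁ ∷ es)
          ≈⟨ *-congˡ {b} (sublistSum-take w (PM? ∘ (h₀ ∷_)) h₁ es
               (sublistSum-map-none w (PM? ∘ (h₀ ∷_)) shift
                 (λ S pm → uncovered S (pm (row₁ , zero))) (gridEdges (suc k)))) ⟩
        b * (b * sublistSum w both es)  ≈⟨ *-assoc b b _ ⟨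
        b * b * sublistSum w both es    ≈⟨ *-congˡ {b * b} (horizontal-sum k) ⟩
        b * b * matchingSum (H a b k)   ∎

-- The linear and the quadratic recurrence of the matching sums

module Ladder (R : CommutativeRing c ℓ) where
  open CommutativeRing R hiding (zero)
  open Exp semiring using (_^_)
  open RingSolver commutativeSemiring using (solve; _:=_; _:+_; _:*_; con)

  Z : Carrier → Carrier → ℕ → Carrier
  Z a b 0             = 1#
  Z a b 1             = 1#
  Z a b (suc (suc k)) = Z b a (suc k) + b * b * Z a b k

  module _ (a b : Carrier) where

    P : ℕ → Carrier
    P k = Z a b (k ℕ.* 2)

    -- The denominator `m⁺ a b (3 + k)`, without truncated subtraction.
    monomial : ℕ → Carrier
    monomial k = a ^ suc k * b ^ k

    -- With q the odd sum `Z b a (suc (k * 2))`, unfolding gives P (1 + k) = q + b² P k and P (2 +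
    -- k) = (1 + b²) P (1 + k) + a² q; eliminating q gives the claim.
    P-linear : ∀ k → P (2 ℕ.+ k) + a * a * (b * b) * P k ≈ (1# + a * a + b * b) * P (1 ℕ.+ k)
    P-linear k = solve 4 (λ a b p q →
      (((q :+ b :* b :* p) :+ a :* a :* q) :+ b :* b :* (q :+ b :* b :* p)) :+
        a :* a :* (b :* b) :* p :=
      (con 1 :+ a :* a :+ b :* b) :* (q :+ b :* b :* p))
      refl a b (P k) (Z b a (suc (k ℕ.* 2)))

    P-quadratic : ∀ k →
      P (2 ℕ.+ k) * P k ≈ P (1 ℕ.+ k) * P (1 ℕ.+ k) + monomial k * monomial k
    P-quadratic zero = solve 2 (λ a b →
      let P₁ = con 1 :+ b :* b :* con 1 in
      ((P₁ :+ a :* a :* con 1) :+ b :* b :* P₁) :* con 1 :=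
      P₁ :* P₁ :+ ((a :* con 1) :* con 1) :* ((a :* con 1) :* con 1))
      refl a b
    -- Adding δ P₁² to both sides avoids subtraction, which the semiring solver does not handle.
    -- `P-linear` is then used at `suc k` and, in reverse, at `k`; both times its right side, times
    -- the other factor, is T P₁ P₂.
    P-quadratic (suc k) = +-cancelʳ (δ * (P₁ * P₁)) _ _ (begin
      P₃ * P₁ + δ * (P₁ * P₁)
        ≈⟨ solve 3 (λ P₁ P₃ δ → P₃ :* P₁ :+ δ :* (P₁ :* P₁) := (P₃ :+ δ :* P₁) :* P₁)
             refl P₁ P₃ δ ⟩
      (P₃ + δ * P₁) * P₁
        ≈⟨ *-congʳ (P-linear (suc k)) ⟩
      T * P₂ * P₁
        ≈⟨ solve 3 (λ T P₁ P₂ → T :* P₂ :* P₁ := T :* P₁ :* P₂) refl T P₁ P₂ ⟩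
      T * P₁ * P₂
        ≈⟨ *-congʳ (P-linear k) ⟨
      (P₂ + δ * P k) * P₂
        ≈⟨ solve 3 (λ P₀ P₂ δ → (P₂ :+ δ :* P₀) :* P₂ := P₂ :* P₂ :+ δ :* (P₂ :* P₀))
             refl (P k) P₂ δ ⟩
      P₂ * P₂ + δ * (P₂ * P k)
        ≈⟨ +-congˡ (*-congˡ (P-quadratic k)) ⟩
      P₂ * P₂ + δ * (P₁ * P₁ + monomial k * monomial k)
        ≈⟨ solve 6 (λ a b A B P₁ P₂ →
             let δ = a :* a :* (b :* b) in
             P₂ :* P₂ :+ δ :* (P₁ :* P₁ :+ (A :* B) :* (A :* B)) :=
             P₂ :* P₂ :+ ((a :* A) :* (b :* B)) :* ((a :* A) :* (b :* B)) :+ δ :* (P₁ :* P₁))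
             refl a b (a ^ suc k) (b ^ k) P₁ P₂ ⟩
      P₂ * P₂ + monomial (suc k) * monomial (suc k) + δ * (P₁ * P₁)  ∎)
      where
      open SetoidReasoning setoid
      open GroupProperties +-group using () renaming (∙-cancelʳ to +-cancelʳ)
      T  = 1# + a * a + b * b
      δ  = a * a * (b * b)
      P₁ = P (1 ℕ.+ k)
      P₂ = P (2 ℕ.+ k)
      P₃ = P (3 ℕ.+ k)

-- Solutions of the cluster recurrence in the field of fractions

module FractionProperties (D : IntegralDomain c ℓ) where
  open IntegralDomain D
  open Fractions D
    renaming (Fraction to Frac; _/_⟨_⟩ to _÷_⟨_⟩; num to numer; den to denom; embed to ι)
    hiding (den≉0)
  private module F = CommutativeRing fractionRing
  open Exp F.semiring renaming (_^_ to _^ᶠ_)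
  open RingSolver commutativeSemiring using (solve; _:=_; _:+_; _:*_; con)

  num≉0⇒≄0 : ∀ {x} → ¬ numer x ≈ 0# → ¬ x ≃ F.0#
  num≉0⇒≄0 n≉0 (mk≃ e) = n≉0 (trans (sym (*-identityʳ _)) (trans e (zeroˡ _)))

  ⊠-cancelʳ : ∀ {x y z} → ¬ z ≃ F.0# → x ⊠ z ≃ y ⊠ z → x ≃ y
  ⊠-cancelʳ {x} {y} {z} z≄0 xz≃yz = begin
    x                          ≈⟨ undo x ⟨
    (x ⊠ z) ⊠ z ⁻¹⟨ z≄0 ⟩      ≈⟨ F.*-congʳ {z ⁻¹⟨ z≄0 ⟩} xz≃yz ⟩
    (y ⊠ z) ⊠ z ⁻¹⟨ z≄0 ⟩      ≈⟨ undo y ⟩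
    y                          ∎
    where
    open SetoidReasoning F.setoid
    undo : ∀ w → (w ⊠ z) ⊠ z ⁻¹⟨ z≄0 ⟩ ≃ w
    undo w = F.trans (F.*-assoc w z (z ⁻¹⟨ z≄0 ⟩))
      (F.trans (F.*-congˡ {w} (⁻¹-inverse z z≄0)) (F.*-identityʳ w))

  Recurrence : (ℕ → Frac) → Set _
  Recurrence x = ∀ k → x (2 ℕ.+ k) ⊠ x k ≃ x (1 ℕ.+ k) ^ᶠ 2 ⊞ F.1#

  -- Induction on pairs of consecutive terms: `x k` is replaced by `u k` on the left of the
  -- recurrence, and the nonzero factor `u k` is cancelled.
  recurrence-unique : ∀ {x u} → Recurrence x → Recurrence u → (∀ k → ¬ u k ≃ F.0#) →
    x 0 ≃ u 0 → x 1 ≃ u 1 → ∀ k → x k ≃ u k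
  recurrence-unique {x} {u} x-rec u-rec u≄0 x₀≃u₀ x₁≃u₁ k = proj₁ (both k)
    where
    open SetoidReasoning F.setoid
    both : ∀ k → x k ≃ u k × x (1 ℕ.+ k) ≃ u (1 ℕ.+ k)
    both zero    = x₀≃u₀ , x₁≃u₁
    both (suc k) = let (e₀ , e₁) = both k in
      e₁ , ⊠-cancelʳ {x (2 ℕ.+ k)} {u (2 ℕ.+ k)} (u≄0 k) (begin
        x (2 ℕ.+ k) ⊠ u k             ≈⟨ F.*-congˡ {x (2 ℕ.+ k)} e₀ ⟨
        x (2 ℕ.+ k) ⊠ x k             ≈⟨ x-rec k ⟩
        x (1 ℕ.+ k) ^ᶠ 2 ⊞ F.1#       ≈⟨ F.+-congʳ {F.1#} (^-congˡ 2 e₁) ⟩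
        u (1 ℕ.+ k) ^ᶠ 2 ⊞ F.1#       ≈⟨ u-rec k ⟨
        u (2 ℕ.+ k) ⊠ u k             ∎)

  -- Reduces the recurrence to a cross-multiplied identity free of the unit factors that `y ^ᶠ 2`
  -- and the summand one bring in.
  quotient-recurrence : ∀ {x y z} →
    (numer z * numer x) * (denom y * denom y) ≈
      (numer y * numer y + denom y * denom y) * (denom z * denom x) →
    z ⊠ x ≃ y ^ᶠ 2 ⊞ F.1#
  quotient-recurrence {x} {y} {z} e = mk≃ (begin
    (numer z * numer x) * (denom y * (denom y * 1#) * 1#)
      ≈⟨ solve 3 (λ n d z → n :* (d :* (d :* con 1) :* con 1) := n :* (d :* d))
           refl (numer z * numer x) (denom y) 1# ⟩
    (numer z * numer x) * (denom y * denom y)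
      ≈⟨ e ⟩
    (numer y * numer y + denom y * denom y) * (denom z * denom x)
      ≈⟨ solve 3 (λ n d m → (n :* n :+ d :* d) :* m :=
           (n :* (n :* con 1) :* con 1 :+ con 1 :* (d :* (d :* con 1))) :* m)
           refl (numer y) (denom y) (denom z * denom x) ⟩
    (numer y * (numer y * 1#) * 1# + 1# * (denom y * (denom y * 1#))) * (denom z * denom x)  ∎)
    where open SetoidReasoning setoid

  module _ {a b : Carrier} (a≉0 : ¬ a ≈ 0#) (b≉0 : ¬ b ≈ 0#) where
    open Ladder commutativeRing

    monomial≉0 : ∀ k → ¬ monomial a b k ≈ 0#
    monomial≉0 k = *-nonzero (^-nonzero (suc k) a≉0) (^-nonzero k b≉0)

    -- The explicit solution. The index starts at the two initial values, so the quotient at `2 + k`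
    -- belongs to the graph of index `3 + k`.
    cluster : ℕ → Frac
    cluster 0             = ι a
    cluster 1             = ι b
    cluster (suc (suc k)) = P a b (suc k) ÷ monomial a b k ⟨ monomial≉0 k ⟩

    cluster-recurrence : Recurrence cluster
    cluster-recurrence 0 = quotient-recurrence
      {cluster 0} {cluster 1} {cluster 2}
      (solve 2 (λ a b →
        ((con 1 :+ b :* b :* con 1) :* a) :* (con 1 :* con 1) :=
        (b :* b :+ con 1 :* con 1) :* (((a :* con 1) :* con 1) :* con 1)) refl a b)
    -- `cluster 1` is `b` over one, not a quotient by a `monomial`; since `P a b 0` is one,
    -- `P-quadratic` at zero still applies after moving `b` to the other factor.
    cluster-recurrence 1 = quotient-recurrence
      {cluster 1} {cluster 2} {cluster 3} (begin
        (P a b 2 * b) * (m₀ * m₀)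
          ≈⟨ solve 3 (λ P₂ a b →
               (P₂ :* b) :* (((a :* con 1) :* con 1) :* ((a :* con 1) :* con 1)) :=
               (P₂ :* con 1) :* (((a :* (a :* con 1)) :* (b :* con 1)) :* con 1))
               refl (P a b 2) a b ⟩
        (P a b 2 * P a b 0) * (monomial a b 1 * 1#)
          ≈⟨ *-congʳ (P-quadratic a b 0) ⟩
        (P a b 1 * P a b 1 + m₀ * m₀) * (monomial a b 1 * 1#)  ∎)
      where
      open SetoidReasoning setoid
      m₀ = monomial a b 0
    cluster-recurrence (suc (suc k)) = quotient-recurrence
      {cluster (2 ℕ.+ k)} {cluster (3 ℕ.+ k)} {cluster (4 ℕ.+ k)}
      -- The numerators satisfy `P-quadratic`, and the square of each `monomial` is the product of
      -- its two neighbours.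
      (*-cong (P-quadratic a b (suc k))
        (solve 4 (λ a b A B →
          ((a :* A) :* (b :* B)) :* ((a :* A) :* (b :* B)) :=
          ((a :* (a :* A)) :* (b :* (b :* B))) :* (A :* B)) refl a b (a ^ suc k) (b ^ k)))

    cluster-unique : (∀ k → ¬ P a b k ≈ 0#) → ∀ {x} → Recurrence x →
      x 0 ≃ ι a → x 1 ≃ ι b → ∀ k → x k ≃ cluster k
    cluster-unique P≉0 {x} x-rec = recurrence-unique {x} {cluster} x-rec cluster-recurrence nonzero
      where
      nonzero : ∀ k → ¬ cluster k ≃ F.0#
      nonzero 0             = num≉0⇒≄0 {cluster 0} a≉0
      nonzero 1             = num≉0⇒≄0 {cluster 1} b≉0
      nonzero (suc (suc k)) = num≉0⇒≄0 {cluster (suc (suc k))} (P≉0 (suc k))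

-- Constant terms of polynomials

module _ (D : IntegralDomain c ℓ) where
  open IntegralDomain D
  open Polynomial D

  coeff-zero-⊛ : ∀ p q → coeff (p ⊛ q) 0 ≈ coeff p 0 * coeff q 0
  coeff-zero-⊛ []      q = sym (zeroˡ _)
  coeff-zero-⊛ (a ∷ p) q = trans (coeff-⊕ (a · q) (0# ∷ p ⊛ q) 0)
    (trans (+-identityʳ _) (coeff-· a q 0))

constantTerm : Pol.Carrier → ℚ.ℚ
constantTerm p = ℚ[x₁].coeff (ℚ[x₁][x₂].coeff p 0) 0

constantTerm-+ : ∀ p q → constantTerm (p Pol.+ q) ≡ constantTerm p ℚ.+ constantTerm q
constantTerm-+ p q = ≡.trans (ℚ[x₁].at (ℚ[x₁][x₂].coeff-⊕ p q 0) 0)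
  (ℚ[x₁].coeff-⊕ (ℚ[x₁][x₂].coeff p 0) (ℚ[x₁][x₂].coeff q 0) 0)

constantTerm-* : ∀ p q → constantTerm (p Pol.* q) ≡ constantTerm p ℚ.* constantTerm q
constantTerm-* p q = ≡.trans (ℚ[x₁].at (coeff-zero-⊛ ℚ[x₁].polynomials p q) 0)
  (coeff-zero-⊛ rationals (ℚ[x₁][x₂].coeff p 0) (ℚ[x₁][x₂].coeff q 0))

-- Matching sums as numerators of the solution

open Ladder Pol.commutativeRing using (Z; P; monomial)
open Fractions ℚ[x₁,x₂] using (mk≃; cross)
open FractionProperties ℚ[x₁,x₂]

matchingSum≈Z : ∀ a b k → matchingSum (H a b k) Pol.≈ Z a b k
matchingSum≈Z a b 0             = Pol.+-identityʳ Pol.1#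
matchingSum≈Z a b 1             =
  Pol.trans (Pol.+-identityʳ (Pol.1# Pol.* Pol.1#)) (Pol.*-identityʳ Pol.1#)
matchingSum≈Z a b (suc (suc k)) = Pol.trans (Grid.matchingSum-grid a b k)
  (Pol.+-cong (matchingSum≈Z b a (suc k)) (Pol.*-congˡ {b Pol.* b} (matchingSum≈Z a b k)))

-- The summand added in each step has the factor b², whose constant term is zero. Both hypotheses
-- are carried along because `a` and `b` swap.
constantTerm-Z : ∀ {a b} → constantTerm a ≡ ℚ.0ℚ → constantTerm b ≡ ℚ.0ℚ →
                 ∀ k → constantTerm (Z a b k) ≡ ℚ.1ℚ
constantTerm-Z         a₀≡0 b₀≡0 0             = ≡.refl
constantTerm-Z         a₀≡0 b₀≡0 1             = ≡.refl
constantTerm-Z {a} {b} a₀≡0 b₀≡0 (suc (suc k)) = begin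
  constantTerm (Z b a (suc k) Pol.+ b Pol.* b Pol.* Z a b k)
    ≡⟨ constantTerm-+ (Z b a (suc k)) (b Pol.* b Pol.* Z a b k) ⟩
  constantTerm (Z b a (suc k)) ℚ.+ constantTerm (b Pol.* b Pol.* Z a b k)
    ≡⟨ ≡.cong₂ ℚ._+_ (constantTerm-Z b₀≡0 a₀≡0 (suc k))
         (≡.trans (constantTerm-* (b Pol.* b) (Z a b k))
           (≡.cong (ℚ._* constantTerm (Z a b k)) (constantTerm-* b b))) ⟩
  ℚ.1ℚ ℚ.+ constantTerm b ℚ.* constantTerm b ℚ.* constantTerm (Z a b k)
    ≡⟨ ≡.cong (λ t → ℚ.1ℚ ℚ.+ t ℚ.* t ℚ.* constantTerm (Z a b k)) b₀≡0 ⟩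
  ℚ.1ℚ ℚ.+ ℚ.0ℚ ℚ.* constantTerm (Z a b k)
    ≡⟨ ≡.cong (ℚ.1ℚ ℚ.+_) (ℚ.*-zeroˡ (constantTerm (Z a b k))) ⟩
  ℚ.1ℚ  ∎
  where open ≡.≡-Reasoning

Z≉0 : ∀ {a b} → constantTerm a ≡ ℚ.0ℚ → constantTerm b ≡ ℚ.0ℚ → ∀ k → ¬ Z a b k Pol.≈ Pol.0#
Z≉0 a₀≡0 b₀≡0 k Z≈0
  with ≡.trans (≡.sym (constantTerm-Z a₀≡0 b₀≡0 k)) (ℚ[x₁].at (ℚ[x₁][x₂].at Z≈0 0) 0)
... | ()

-- Once the factors are commuted, the product computes to `6 + k * 2`, so the truncated subtraction
-- computes too.
grid-size : ∀ k → 2 ℕ.* (3 ℕ.+ k) ℕ.∸ 4 ≡ suc k ℕ.* 2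
grid-size k = ≡.cong (ℕ._∸ 4) (ℕ.*-comm 2 (3 ℕ.+ k))

module _ {a b : Pol.Carrier} (a≉0 : ¬ a Pol.≈ Pol.0#) (b≉0 : ¬ b Pol.≈ Pol.0#)
         (a₀≡0 : constantTerm a ≡ ℚ.0ℚ) (b₀≡0 : constantTerm b ≡ ℚ.0ℚ) where

  cluster-matchings : ∀ {x} → Recurrence x → x 0 Rat.≈ embed a → x 1 Rat.≈ embed b →
    ∀ k m≉0 → x (2 ℕ.+ k) Rat.≈ (matchingSum (G⁺ a b (3 ℕ.+ k)) / m⁺ a b (3 ℕ.+ k) ⟨ m≉0 ⟩)
  -- Equality of fractions ignores the proofs that denominators are nonzero, so any `m≉0` will do.
  -- The denominators agree by computation and only the numerator is rewritten.
  cluster-matchings {x} x-rec x₀≈a x₁≈b k m≉0 = mk≃ (Pol.trans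
    (cross (cluster-unique a≉0 b≉0 (λ k → Z≉0 a₀≡0 b₀≡0 (k ℕ.* 2)) {x} x-rec x₀≈a x₁≈b (2 ℕ.+ k)))
    (Pol.*-congʳ {den (x (2 ℕ.+ k))} (Pol.sym
      (≡.subst (λ s → matchingSum (H a b s) Pol.≈ P a b (suc k)) (≡.sym (grid-size k))
        (matchingSum≈Z a b (suc k ℕ.* 2))))))

-- The sequence read in both directions

module _ {x : ℤ → Fraction} (seq : IsClusterSequence x) where
  open IsClusterSequence seq

  forward-recurrence : Recurrence (λ k → x (+ suc k))
  forward-recurrence k = recurrence (+ (3 ℕ.+ k))

  -- The relation is symmetric in its two outer terms, so it survives reversal; it is taken at n = 2
  -- - k.
  backward-recurrence : Recurrence (λ k → x (+ 2 ℤ.- + k))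
  backward-recurrence k = begin
    x (+ 2 ℤ.- + (2 ℕ.+ k)) Rat.* x n  ≈⟨ Rat.*-comm (x (+ 2 ℤ.- + (2 ℕ.+ k))) (x n) ⟩
    x n Rat.* x (+ 2 ℤ.- + (2 ℕ.+ k))  ≡⟨ ≡.cong (λ i → x n Rat.* x i) (step 2) ⟨
    x n Rat.* x (n ℤ.- + 2)            ≈⟨ recurrence n ⟩
    x (n ℤ.- + 1) Rat.^ 2 Rat.+ Rat.1# ≡⟨ ≡.cong (λ i → x i Rat.^ 2 Rat.+ Rat.1#) (step 1) ⟩
    x (+ 2 ℤ.- + suc k) Rat.^ 2 Rat.+ Rat.1#  ∎
    where
    open SetoidReasoning Rat.setoid
    n = + 2 ℤ.- + k
    step : ∀ i → n ℤ.- + i ≡ + 2 ℤ.- + (i ℕ.+ k)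
    step i = ≡.trans (ℤ.+-assoc (+ 2) (ℤ.- + k) (ℤ.- + i)) (≡.cong (λ j → + 2 ℤ.+ j)
      (≡.trans (≡.sym (ℤ.neg-distrib-+ (+ k) (+ i))) (≡.cong (λ j → ℤ.- + j) (ℕ.+-comm k i))))

theorem1 : ∀ (x : ℤ → Fraction) → IsClusterSequence x →
    ∀ (n : ℤ) → n ≢ + 1 → n ≢ + 2 → x n Rat.≈ (p n / m n ⟨ m≉0 n ⟩)
theorem1 x seq (+ 1)                   n≢1 n≢2 = contradiction ≡.refl n≢1
theorem1 x seq (+ 2)                   n≢1 n≢2 = contradiction ≡.refl n≢2
theorem1 x seq (+ suc (suc (suc k)))   n≢1 n≢2 =
  cluster-matchings X₁≉0 X₂≉0 ≡.refl ≡.refl {λ k → x (+ suc k)} (forward-recurrence seq)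
    (IsClusterSequence.x₁ seq) (IsClusterSequence.x₂ seq) k (m≉0 (+ suc (suc (suc k))))
-- Reversed, the sequence starts with `X₂`, `X₁`, matching the interchanged weights of the graph;
-- here n = 2 - 2.
theorem1 x seq (+ 0)                   n≢1 n≢2 =
  cluster-matchings X₂≉0 X₁≉0 ≡.refl ≡.refl {λ k → x (+ 2 ℤ.- + k)} (backward-recurrence seq)
    (IsClusterSequence.x₂ seq) (IsClusterSequence.x₁ seq) 0 (m≉0 (+ 0))
-- Here n = -(1 + k) = 2 - (2 + suc k), and 3 - n = 3 + suc k, whence the index `suc k`.
theorem1 x seq -[1+ k ]                n≢1 n≢2 =
  cluster-matchings X₂≉0 X₁≉0 ≡.refl ≡.refl {λ k → x (+ 2 ℤ.- + k)} (backward-recurrence seq)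
    (IsClusterSequence.x₂ seq) (IsClusterSequence.x₁ seq) (suc k) (m≉0 -[1+ k ])
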